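{- Let $n\ge 4$ and let $W_n^\sigma=(W_n,\sigma)$ be a signed wheel. Then $W_n^\sigma$ is distance compatible if and only if it contains no negative cycle of length $4$ having the central vertex of the wheel as one of its vertices.
   Context: The wheel $W_n$ is the join of a cycle $C_n$ with $K_1$; the vertex of $K_1$ is the central vertex and the vertices of $C_n$ are rim vertices. A signed graph is $(G,\sigma)$ with $\sigma:E(G)\to\{+1,-1\}$; the sign of a path or cycle is the product of its edge signs; a cycle is negative if its sign is $-1$. For vertices $u,v$, $\sigma_{\max}(uv)=-1$ if every shortest $u$–$v$ path in $G$ is negative and $+1$ otherwise; $\sigma_{\min}(uv)=+1$ if every shortest $u$–$v$ path is positive and $-1$ otherwise; $d^{\max}(u,v)=\sigma_{\max}(uv)d(u,v)$, $d^{\min}(u,v)=\sigma_{\min}(uv)d(u,v)$ with $d$ the graph distance. The signed graph is distance compatible if $d^{\max}(u,v)=d^{\min}(u,v)$ for all vertices $u,v$. -}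

module Defs where

open import Data.Nat using (ℕ; zero; suc; _+_; _≤_)
open import Data.Fin using (Fin; zero; suc; toℕ; inject₁; fromℕ; #_)
open import Data.Integer using (ℤ; _◃_)
open import Data.Sign using (Sign) renaming (_*_ to _·_)
open import Data.Product using (Σ; ∃; _×_; _,_)
open import Data.Sum using (_⊎_)
open import Data.Unit using (⊤)
open import Data.Empty using (⊥)
open import Relation.Binary.PropositionalEquality using (_≡_)
open import Function.Definitions using (Injective)

------------------------------------------------------------------------
-- Signed graphs (general notions)

-- A signature on a graph with vertex set V and adjacency Adj:
-- a sign for every (ordered) pair, required to be symmetric on edges.
-- Values on non-adjacent pairs are never used.
IsSignature : {V : Set} → (V → V → Set) → (V → V → Sign) → Set
IsSignature {V} Adj σ = (u v : V) → Adj u v → σ u v ≡ σ v u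

-- product of signs over Fin k
prodSign : (k : ℕ) → (Fin k → Sign) → Sign
prodSign zero    f = Sign.+
prodSign (suc k) f = f zero · prodSign k (λ i → f (suc i))

-- A u–v path of length k: distinct vertices p 0, …, p k with
-- consecutive vertices adjacent, p 0 = u, p k = v.
record Path {V : Set} (Adj : V → V → Set) (u v : V) (k : ℕ) : Set where
  field
    vtx      : Fin (suc k) → V
    start    : vtx zero ≡ u
    end      : vtx (fromℕ k) ≡ v
    adjacent : (i : Fin k) → Adj (vtx (inject₁ i)) (vtx (suc i))
    distinct : Injective _≡_ _≡_ vtx

-- sign of a path = product of its edge signs
pathSign : {V : Set} {Adj : V → V → Set} {u v : V} {k : ℕ} →
           (σ : V → V → Sign) → Path Adj u v k → Sign
pathSign {k = k} σ P = prodSign k (λ i → σ (vtx (inject₁ i)) (vtx (suc i)))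
  where open Path P

-- d(u,v) = k : there is a u–v path of length k and none shorter
IsDist : {V : Set} → (V → V → Set) → V → V → ℕ → Set
IsDist Adj u v k = Path Adj u v k × (∀ m → Path Adj u v m → k ≤ m)

-- a shortest u–v path (its length is the distance)
Shortest : {V : Set} → (V → V → Set) → V → V → ℕ → Set
Shortest Adj u v k = IsDist Adj u v k

-- σmax(uv) = s : s = − iff every shortest u–v path is negative
IsSigmaMax : {V : Set} → (V → V → Set) → (V → V → Sign) → V → V → Sign → Set
IsSigmaMax Adj σ u v s =
  (s ≡ Sign.- → AllNeg) × (AllNeg → s ≡ Sign.-)
  where
  AllNeg : Set
  AllNeg = ∀ k → Shortest Adj u v k → (P : Path Adj u v k) → pathSign σ P ≡ Sign.-

-- σmin(uv) = s : s = + iff every shortest u–v path is positive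
IsSigmaMin : {V : Set} → (V → V → Set) → (V → V → Sign) → V → V → Sign → Set
IsSigmaMin Adj σ u v s =
  (s ≡ Sign.+ → AllPos) × (AllPos → s ≡ Sign.+)
  where
  AllPos : Set
  AllPos = ∀ k → Shortest Adj u v k → (P : Path Adj u v k) → pathSign σ P ≡ Sign.+

-- d^max(u,v) = σmax(uv) d(u,v), d^min(u,v) = σmin(uv) d(u,v)
IsDMax : {V : Set} → (V → V → Set) → (V → V → Sign) → V → V → ℤ → Set
IsDMax Adj σ u v z = ∃ λ d → ∃ λ s → IsDist Adj u v d × IsSigmaMax Adj σ u v s × z ≡ s ◃ d

IsDMin : {V : Set} → (V → V → Set) → (V → V → Sign) → V → V → ℤ → Set
IsDMin Adj σ u v z = ∃ λ d → ∃ λ s → IsDist Adj u v d × IsSigmaMin Adj σ u v s × z ≡ s ◃ d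

-- distance compatible: d^max(u,v) = d^min(u,v) for all u, v
DistanceCompatible : {V : Set} → (V → V → Set) → (V → V → Sign) → Set
DistanceCompatible {V} Adj σ =
  (u v : V) (a b : ℤ) → IsDMax Adj σ u v a → IsDMin Adj σ u v b → a ≡ b

-- a cycle of length 4: distinct vertices c0,c1,c2,c3 with
-- c0c1, c1c2, c2c3, c3c0 edges
record Cycle4 {V : Set} (Adj : V → V → Set) : Set where
  field
    c        : Fin 4 → V
    distinct : Injective _≡_ _≡_ c
    e01      : Adj (c (# 0)) (c (# 1))
    e12      : Adj (c (# 1)) (c (# 2))
    e23      : Adj (c (# 2)) (c (# 3))
    e30      : Adj (c (# 3)) (c (# 0))

cycle4Sign : {V : Set} {Adj : V → V → Set} → (V → V → Sign) → Cycle4 Adj → Sign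
cycle4Sign σ C =
  σ (c (# 0)) (c (# 1)) · (σ (c (# 1)) (c (# 2)) · (σ (c (# 2)) (c (# 3)) · σ (c (# 3)) (c (# 0))))
  where open Cycle4 C

------------------------------------------------------------------------
-- The wheel W_n: vertex set Fin (suc n); vertex zero is the centre,
-- vertex suc i is rim vertex i (i : Fin n); rim is the cycle
-- 0 – 1 – … – (n-1) – 0.

-- j is the successor of i on the rim (mod n)
RimSucc : (n : ℕ) → Fin n → Fin n → Set
RimSucc n i j = (toℕ i + 1 ≡ toℕ j) ⊎ ((toℕ i + 1 ≡ n) × (toℕ j ≡ 0))

WheelAdj : (n : ℕ) → Fin (suc n) → Fin (suc n) → Set
WheelAdj n zero    zero    = ⊥
WheelAdj n zero    (suc j) = ⊤
WheelAdj n (suc i) zero    = ⊤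
WheelAdj n (suc i) (suc j) = RimSucc n i j ⊎ RimSucc n j i

centre : (n : ℕ) → Fin (suc n)
centre n = zero

-- W_n^σ contains a negative 4-cycle through the central vertex
HasNegCentral4Cycle : (n : ℕ) → (Fin (suc n) → Fin (suc n) → Sign) → Set
HasNegCentral4Cycle n σ =
  Σ (Cycle4 (WheelAdj n)) λ C →
    (∃ λ i → Cycle4.c C i ≡ centre n) × cycle4Sign σ C ≡ Sign.-

-- Distance compatibility says exactly that all shortest u–v paths have the
-- same sign.  In a wheel every vertex is within distance 2 of every other,
-- through the centre, so the only shortest paths whose signs can disagree are
-- the 2-paths x–p–y between non-adjacent rim vertices.  Comparing such a path
-- with the path x–centre–y closes the 4-cycle centre–x–p–y, whose sign is the
-- product of the two path signs; so all shortest x–y paths agree exactly when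
-- these central 4-cycles are positive.  Conversely, the neighbours of the
-- centre on a central 4-cycle are non-adjacent because a rim of length at
-- least 4 has no triangles, so a negative central 4-cycle yields two shortest
-- paths of opposite sign.
module Submission where

open import Defs
open import Data.Nat using (ℕ; zero; suc; _+_; _*_; _≤_; z≤n; s≤s)
open import Data.Nat.Properties using (≤-antisym; ≤-trans; m≤m+n; +-identityʳ; +-cancelˡ-≡; <-irrefl)
open import Data.Nat.Tactic.RingSolver using (solve-∀)
open import Data.Fin using (Fin; zero; suc; toℕ; #_)
open import Data.Fin.Properties using (toℕ-injective; toℕ<n)
open import Data.Vec.Functional using (Vector; []; _∷_)
open import Data.Sign using (Sign) renaming (_*_ to _·_)
open import Data.Sign.Properties using (s*s≡+; *-identityʳ; *-cancelʳ-≡; *-assoc; *-comm; *-commutativeSemigroup)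
open import Algebra.Properties.CommutativeSemigroup *-commutativeSemigroup using (x∙yz≈y∙zx)
open import Data.Integer using (_◃_)
open import Data.Product using (Σ; ∃; _×_; _,_; proj₁; proj₂)
open import Data.Sum using (_⊎_; inj₁; inj₂)
open import Data.Unit using (tt)
open import Data.Empty using (⊥; ⊥-elim)
open import Relation.Nullary using (¬_)
open import Relation.Binary.PropositionalEquality
open import Function.Base using (_∘_)
open import Function.Bundles using (_⇔_; mk⇔; Equivalence)
open import Function.Definitions using (Injective)

open ≡-Reasoning

-- Sign arithmetic

≢-⇒≡+ : ∀ {s} → s ≢ Sign.- → s ≡ Sign.+
≢-⇒≡+ {Sign.+} _   = refl
≢-⇒≡+ {Sign.-} s≢- = ⊥-elim (s≢- refl)

≡⇔≡⇒≡ : ∀ c {s t : Sign} → (s ≡ c → t ≡ c) → (t ≡ c → s ≡ c) → s ≡ t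
≡⇔≡⇒≡ Sign.+ {Sign.+} {Sign.+} _ _ = refl
≡⇔≡⇒≡ Sign.+ {Sign.+} {Sign.-} f _ = sym (f refl)
≡⇔≡⇒≡ Sign.+ {Sign.-} {Sign.+} _ g = g refl
≡⇔≡⇒≡ Sign.+ {Sign.-} {Sign.-} _ _ = refl
≡⇔≡⇒≡ Sign.- {Sign.+} {Sign.+} _ _ = refl
≡⇔≡⇒≡ Sign.- {Sign.+} {Sign.-} _ g = g refl
≡⇔≡⇒≡ Sign.- {Sign.-} {Sign.+} f _ = sym (f refl)
≡⇔≡⇒≡ Sign.- {Sign.-} {Sign.-} _ _ = refl

rotate-product : ∀ a b c d → b · (c · (d · a)) ≡ a · (b · (c · d))
rotate-product a b c d = begin
  b · (c · (d · a))   ≡⟨ cong (b ·_) (*-assoc c d a) ⟨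
  b · ((c · d) · a)   ≡⟨ x∙yz≈y∙zx a b (c · d) ⟨
  a · (b · (c · d))   ∎

square-product : ∀ a b c d → a · (b · (c · d)) ≡ (a · d) · (b · c)
square-product a b c d = begin
  a · (b · (c · d))   ≡⟨ cong (a ·_) (*-assoc b c d) ⟨
  a · ((b · c) · d)   ≡⟨ cong (a ·_) (*-comm (b · c) d) ⟩
  a · (d · (b · c))   ≡⟨ *-assoc a d (b · c) ⟨
  (a · d) · (b · c)   ∎

square≡+⇔ : ∀ a b c d → a · (b · (c · d)) ≡ Sign.+ ⇔ a · d ≡ b · c
square≡+⇔ a b c d = mk⇔
  (λ sq≡+ → *-cancelʳ-≡ (b · c) (a · d) (b · c)
     (trans (trans (sym (square-product a b c d)) sq≡+) (sym (s*s≡+ (b · c)))))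
  (λ halves≡ → trans (square-product a b c d)
     (trans (cong (_· (b · c)) halves≡) (s*s≡+ (b · c))))

-- Shortest paths in an arbitrary signed graph

module _ {A : Set} where

  ∷-injective : ∀ {n x} {xs : Vector A n} → (∀ i → x ≢ xs i) →
                Injective _≡_ _≡_ xs → Injective _≡_ _≡_ (x ∷ xs)
  ∷-injective x∉xs xs-inj {zero}  {zero}  _ = refl
  ∷-injective x∉xs xs-inj {zero}  {suc j} e = ⊥-elim (x∉xs j e)
  ∷-injective x∉xs xs-inj {suc i} {zero}  e = ⊥-elim (x∉xs i (sym e))
  ∷-injective x∉xs xs-inj {suc i} {suc j} e = cong suc (xs-inj e)

  []-injective : Injective _≡_ _≡_ ([] {A = A})
  []-injective {()}

  distinct₂ : ∀ {x y} → x ≢ y → Injective _≡_ _≡_ (x ∷ y ∷ [])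
  distinct₂ x≢y = ∷-injective (λ { zero → x≢y }) (∷-injective (λ ()) []-injective)

  distinct₃ : ∀ {x y z} → x ≢ y → x ≢ z → y ≢ z → Injective _≡_ _≡_ (x ∷ y ∷ z ∷ [])
  distinct₃ x≢y x≢z y≢z =
    ∷-injective (λ { zero → x≢y ; (suc zero) → x≢z }) (distinct₂ y≢z)

  distinct₄ : ∀ {w x y z} → w ≢ x → w ≢ y → w ≢ z → x ≢ y → x ≢ z → y ≢ z →
              Injective _≡_ _≡_ (w ∷ x ∷ y ∷ z ∷ [])
  distinct₄ w≢x w≢y w≢z x≢y x≢z y≢z =
    ∷-injective (λ { zero → w≢x ; (suc zero) → w≢y ; (suc (suc zero)) → w≢z })
                (distinct₃ x≢y x≢z y≢z)

ShortestPathsHaveSign : {V : Set} → (V → V → Set) → (V → V → Sign) → V → V → Sign → Set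
ShortestPathsHaveSign Adj σ u v c =
  ∀ k → Shortest Adj u v k → (P : Path Adj u v k) → pathSign σ P ≡ c

ShortestPathsSameSign : {V : Set} → (V → V → Set) → (V → V → Sign) → Set
ShortestPathsSameSign Adj σ = ∀ u v k → Shortest Adj u v k →
  (P Q : Path Adj u v k) → pathSign σ P ≡ pathSign σ Q

module _ {V : Set} {Adj : V → V → Set} where

  path₀ : ∀ u → Path Adj u u 0
  path₀ u = record
    { vtx = u ∷ [] ; start = refl ; end = refl
    ; adjacent = λ () ; distinct = ∷-injective (λ ()) []-injective }

  path₁ : ∀ {u v} → u ≢ v → Adj u v → Path Adj u v 1
  path₁ u≢v uv = record
    { vtx = _ ∷ _ ∷ [] ; start = refl ; end = refl
    ; adjacent = λ { zero → uv } ; distinct = distinct₂ u≢v }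

  path₂ : ∀ {x y z} → x ≢ y → y ≢ z → x ≢ z → Adj x y → Adj y z → Path Adj x z 2
  path₂ x≢y y≢z x≢z xy yz = record
    { vtx = _ ∷ _ ∷ _ ∷ [] ; start = refl ; end = refl
    ; adjacent = λ { zero → xy ; (suc zero) → yz } ; distinct = distinct₃ x≢y x≢z y≢z }

  path₀-endpoints : ∀ {u v} → Path Adj u v 0 → u ≡ v
  path₀-endpoints record { start = refl ; end = refl } = refl

  path₁-adjacent : ∀ {u v} → Path Adj u v 1 → Adj u v
  path₁-adjacent record { start = refl ; end = refl ; adjacent = adj } = adj zero

  pathSign₁ : ∀ σ {u v} (P : Path Adj u v 1) → pathSign σ P ≡ σ u v
  pathSign₁ σ record { start = refl ; end = refl } = *-identityʳ _

  middle : ∀ {u v} → Path Adj u v 2 → V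
  middle P = Path.vtx P (suc zero)

  pathSign₂ : ∀ σ {u v} (P : Path Adj u v 2) → pathSign σ P ≡ σ u (middle P) · σ (middle P) v
  pathSign₂ σ record { vtx = vtx ; start = refl ; end = refl } =
    cong (σ (vtx zero) (vtx (suc zero)) ·_) (*-identityʳ _)

  IsDist-unique : ∀ {u v k l} → IsDist Adj u v k → IsDist Adj u v l → k ≡ l
  IsDist-unique (P , P-min) (Q , Q-min) = ≤-antisym (P-min _ Q) (Q-min _ P)

  IsDist-2+ : ∀ {u v k} → IsDist Adj u v (suc (suc k)) → u ≢ v × ¬ Adj u v
  IsDist-2+ {u} {v} (_ , minimal) = u≢v , ¬uv
    where
    u≢v : u ≢ v
    u≢v refl with minimal 0 (path₀ u)
    ... | ()
    ¬uv : ¬ Adj u v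
    ¬uv uv with minimal 1 (path₁ u≢v uv)
    ... | s≤s ()

  IsDist-2 : ∀ {u v} → u ≢ v → ¬ Adj u v → Path Adj u v 2 → IsDist Adj u v 2
  IsDist-2 u≢v ¬uv P = P , minimal
    where
    minimal : ∀ m → Path Adj _ _ m → 2 ≤ m
    minimal zero          Q = ⊥-elim (u≢v (path₀-endpoints Q))
    minimal (suc zero)    Q = ⊥-elim (¬uv (path₁-adjacent Q))
    minimal (suc (suc m)) Q = s≤s (s≤s z≤n)

  module _ (σ : V → V → Sign) where

    module _ (same : ShortestPathsSameSign Adj σ) {u v d} (dist : IsDist Adj u v d) where

      shortest-sign : ∀ {c} → pathSign σ (proj₁ dist) ≡ c → ShortestPathsHaveSign Adj σ u v c
      shortest-sign P≡c k distₖ Q with IsDist-unique distₖ dist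
      ... | refl = trans (same u v k distₖ Q (proj₁ dist)) P≡c

      -- IsSigmaMax and IsSigmaMin have exactly this shape, with c = - and c = +.
      characterised-sign : ∀ c {s} → (s ≡ c → ShortestPathsHaveSign Adj σ u v c) →
        (ShortestPathsHaveSign Adj σ u v c → s ≡ c) → s ≡ pathSign σ (proj₁ dist)
      characterised-sign c s⇒all all⇒s =
        ≡⇔≡⇒≡ c (λ s≡c → s⇒all s≡c d dist (proj₁ dist))
                (λ P≡c → all⇒s (shortest-sign P≡c))

    sameSign⇒compatible : ShortestPathsSameSign Adj σ → DistanceCompatible Adj σ
    sameSign⇒compatible same u v _ _
      (d , s , dist , (max⇒ , ⇒max) , refl) (d′ , s′ , dist′ , (min⇒ , ⇒min) , refl)
      with IsDist-unique dist dist′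
    ... | refl = cong (_◃ d) (begin
      s                        ≡⟨ characterised-sign same dist Sign.- max⇒ ⇒max ⟩
      pathSign σ (proj₁ dist)  ≡⟨ same u v d dist (proj₁ dist) (proj₁ dist′) ⟩
      pathSign σ (proj₁ dist′) ≡⟨ characterised-sign same dist′ Sign.+ min⇒ ⇒min ⟨
      s′                       ∎)

    -- The length must be positive: + ◃ 0 and - ◃ 0 are both 0.
    mixed-signs⇒incompatible : ∀ {u v k} → IsDist Adj u v (suc k) →
      (P Q : Path Adj u v (suc k)) → pathSign σ P ≡ Sign.+ → pathSign σ Q ≡ Sign.- →
      ¬ DistanceCompatible Adj σ
    mixed-signs⇒incompatible {u} {v} {k} dist P Q P≡+ Q≡- compatible
      with compatible u v _ _ (suc k , Sign.+ , dist , ((λ ()) , ⇒max) , refl)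
                              (suc k , Sign.- , dist , ((λ ()) , ⇒min) , refl)
      where
      ⇒max : ShortestPathsHaveSign Adj σ u v Sign.- → Sign.+ ≡ Sign.-
      ⇒max all- = trans (sym P≡+) (all- _ dist P)
      ⇒min : ShortestPathsHaveSign Adj σ u v Sign.+ → Sign.- ≡ Sign.+
      ⇒min all+ = trans (sym Q≡-) (all+ _ dist Q)
    ... | ()

    compatible⇒sameSign : DistanceCompatible Adj σ → ShortestPathsSameSign Adj σ
    compatible⇒sameSign compatible u v zero    dist P Q = refl
    compatible⇒sameSign compatible u v (suc k) dist P Q
      with pathSign σ P in P≡ | pathSign σ Q in Q≡
    ... | Sign.+ | Sign.+ = refl
    ... | Sign.- | Sign.- = refl
    ... | Sign.+ | Sign.- = ⊥-elim (mixed-signs⇒incompatible dist P Q P≡ Q≡ compatible)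
    ... | Sign.- | Sign.+ = ⊥-elim (mixed-signs⇒incompatible dist Q P Q≡ P≡ compatible)

  rotate : Cycle4 Adj → Cycle4 Adj
  rotate C = record
    { c = c ∘ next ; distinct = λ e → next-injective (distinct e)
    ; e01 = e12 ; e12 = e23 ; e23 = e30 ; e30 = e01 }
    where
    open Cycle4 C
    next : Fin 4 → Fin 4
    next = # 1 ∷ # 2 ∷ # 3 ∷ # 0 ∷ []
    next-injective : Injective _≡_ _≡_ next
    next-injective = distinct₄ (λ ()) (λ ()) (λ ()) (λ ()) (λ ()) (λ ())

  rotate-sign : ∀ σ C → cycle4Sign σ (rotate C) ≡ cycle4Sign σ C
  rotate-sign σ C = rotate-product
    (σ (c (# 0)) (c (# 1))) (σ (c (# 1)) (c (# 2))) (σ (c (# 2)) (c (# 3))) (σ (c (# 3)) (c (# 0)))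
    where open Cycle4 C

  rotate-to-front : ∀ σ (C : Cycle4 Adj) i → Σ (Cycle4 Adj) λ C′ →
    Cycle4.c C′ zero ≡ Cycle4.c C i × cycle4Sign σ C′ ≡ cycle4Sign σ C
  rotate-to-front σ C zero = C , refl , refl
  rotate-to-front σ C (suc zero) = rotate C , refl , rotate-sign σ C
  rotate-to-front σ C (suc (suc zero)) =
    rotate (rotate C) , refl , trans (rotate-sign σ (rotate C)) (rotate-sign σ C)
  rotate-to-front σ C (suc (suc (suc zero))) =
    rotate (rotate (rotate C)) , refl ,
    trans (rotate-sign σ (rotate (rotate C)))
          (trans (rotate-sign σ (rotate C)) (rotate-sign σ C))

-- The rim

RimAdjacent : (n : ℕ) → Fin n → Fin n → Set
RimAdjacent n i j = RimSucc n i j ⊎ RimSucc n j i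

module _ {n : ℕ} where

  RimSucc-functional : ∀ {i j k : Fin n} → RimSucc n i j → RimSucc n i k → j ≡ k
  RimSucc-functional (inj₁ j≡) (inj₁ k≡) = toℕ-injective (trans (sym j≡) k≡)
  RimSucc-functional (inj₂ (_ , j≡0)) (inj₂ (_ , k≡0)) = toℕ-injective (trans j≡0 (sym k≡0))
  RimSucc-functional {j = j} (inj₁ j≡) (inj₂ (≡n , _)) =
    ⊥-elim (<-irrefl (trans (sym j≡) ≡n) (toℕ<n j))
  RimSucc-functional {k = k} (inj₂ (≡n , _)) (inj₁ k≡) =
    ⊥-elim (<-irrefl (trans (sym k≡) ≡n) (toℕ<n k))

  RimSucc-winding : ∀ {i j : Fin n} → RimSucc n i j → ∃ λ w → toℕ i + 1 ≡ toℕ j + w * n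
  RimSucc-winding {j = j} (inj₁ j≡) = 0 , trans j≡ (sym (+-identityʳ (toℕ j)))
  RimSucc-winding {j = j} (inj₂ (≡n , j≡0)) rewrite j≡0 =
    1 , trans ≡n (sym (+-identityʳ n))

three-steps-total : ∀ a b c x y z →
  a + 1 ≡ b + x → b + 1 ≡ c + y → c + 1 ≡ a + z → x + y + z ≡ 3
three-steps-total a b c x y z ab bc ca = +-cancelˡ-≡ (a + b + c) _ _ (begin
  (a + b + c) + (x + y + z)      ≡⟨ gather-steps a b c x y z ⟨
  (b + x) + (c + y) + (a + z)    ≡⟨ cong₂ _+_ (cong₂ _+_ ab bc) ca ⟨
  (a + 1) + (b + 1) + (c + 1)    ≡⟨ gather-ones a b c ⟩
  (a + b + c) + 3                ∎)
  where
  gather-steps : ∀ a b c x y z → (b + x) + (c + y) + (a + z) ≡ (a + b + c) + (x + y + z)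
  gather-steps = solve-∀
  gather-ones : ∀ a b c → (a + 1) + (b + 1) + (c + 1) ≡ (a + b + c) + 3
  gather-ones = solve-∀

multiple≢3 : ∀ {n} → 4 ≤ n → ∀ w → w * n ≢ 3
multiple≢3 4≤n zero ()
multiple≢3 {n} 4≤n (suc w) e with subst (4 ≤_) e (≤-trans 4≤n (m≤m+n n (w * n)))
... | s≤s (s≤s (s≤s ()))

module _ {n : ℕ} (4≤n : 4 ≤ n) where

  -- Once around a 3-cycle the index gains 3, which must be a multiple of n.
  no-RimSucc-3cycle : ∀ {i j k : Fin n} → RimSucc n i j → RimSucc n j k → RimSucc n k i → ⊥
  no-RimSucc-3cycle ij jk ki
    with RimSucc-winding ij | RimSucc-winding jk | RimSucc-winding ki
  ... | w₁ , e₁ | w₂ , e₂ | w₃ , e₃ = multiple≢3 4≤n (w₁ + w₂ + w₃)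
    (trans (distrib w₁ w₂ w₃ n) (three-steps-total _ _ _ _ _ _ e₁ e₂ e₃))
    where
    distrib : ∀ a b c m → (a + b + c) * m ≡ a * m + b * m + c * m
    distrib = solve-∀

  rim-triangle-free : ∀ {i j k : Fin n} → i ≢ j → j ≢ k → i ≢ k →
    RimAdjacent n i j → RimAdjacent n j k → RimAdjacent n i k → ⊥
  rim-triangle-free _   j≢k _   (inj₁ ij) _         (inj₁ ik) = j≢k (RimSucc-functional ij ik)
  rim-triangle-free _   _   i≢k (inj₂ ji) (inj₁ jk) _         = i≢k (RimSucc-functional ji jk)
  rim-triangle-free i≢j _   _   _         (inj₂ kj) (inj₂ ki) = i≢j (RimSucc-functional ki kj)
  rim-triangle-free _   _   _   (inj₁ ij) (inj₁ jk) (inj₂ ki) = no-RimSucc-3cycle ij jk ki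
  rim-triangle-free _   _   _   (inj₂ ji) (inj₂ kj) (inj₁ ik) = no-RimSucc-3cycle ik kj ji

-- The wheel

via-centre : ∀ {n} {u v : Fin (suc n)} → u ≢ v → ¬ WheelAdj n u v → Path (WheelAdj n) u v 2
via-centre {u = zero}  {zero}  u≢v _   = ⊥-elim (u≢v refl)
via-centre {u = zero}  {suc _} _   ¬uv = ⊥-elim (¬uv tt)
via-centre {u = suc _} {zero}  _   ¬uv = ⊥-elim (¬uv tt)
via-centre {u = suc _} {suc _} u≢v _   = path₂ {y = zero} (λ ()) (λ ()) u≢v tt tt

module _ (n : ℕ) (σ : Fin (suc n) → Fin (suc n) → Sign) (σ-sym : IsSignature (WheelAdj n) σ) where

  detour-sign : ¬ HasNegCentral4Cycle n σ → ∀ {x p y} → x ≢ p → p ≢ y → x ≢ y →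
    ¬ WheelAdj n x y → WheelAdj n x p → WheelAdj n p y → σ x p · σ p y ≡ σ x zero · σ zero y
  detour-sign _ {p = zero} _ _ _ _ _ _ = refl
  detour-sign _ {zero}  {suc _} {zero}  _ _ x≢y _   _ _ = ⊥-elim (x≢y refl)
  detour-sign _ {zero}  {suc _} {suc _} _ _ _   ¬xy _ _ = ⊥-elim (¬xy tt)
  detour-sign _ {suc _} {suc _} {zero}  _ _ _   ¬xy _ _ = ⊥-elim (¬xy tt)
  detour-sign noNeg {x@(suc _)} {p@(suc _)} {y@(suc _)} x≢p p≢y x≢y _ xp py = begin
    σ x p · σ p y
      ≡⟨ Equivalence.to (square≡+⇔ (σ zero x) (σ x p) (σ p y) (σ y zero)) square≡+ ⟨
    σ zero x · σ y zero   ≡⟨ cong₂ _·_ (σ-sym zero x tt) (σ-sym y zero tt) ⟩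
    σ x zero · σ zero y   ∎
    where
    square : Cycle4 (WheelAdj n)
    square = record
      { c = zero ∷ x ∷ p ∷ y ∷ []
      ; distinct = distinct₄ (λ ()) (λ ()) (λ ()) x≢p x≢y p≢y
      ; e01 = tt ; e12 = xp ; e23 = py ; e30 = tt }
    square≡+ : cycle4Sign σ square ≡ Sign.+
    square≡+ = ≢-⇒≡+ (λ neg → noNeg (square , (zero , refl) , neg))

  shortest₂-sign : ¬ HasNegCentral4Cycle n σ → ∀ {u v} → u ≢ v → ¬ WheelAdj n u v →
    (P : Path (WheelAdj n) u v 2) → pathSign σ P ≡ σ u zero · σ zero v
  shortest₂-sign noNeg u≢v ¬uv
    P@record { vtx = vtx ; start = refl ; end = refl ; adjacent = adj ; distinct = inj } =
    trans (pathSign₂ σ P)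
          (detour-sign noNeg (vertex≢ (λ ())) (vertex≢ (λ ())) u≢v ¬uv (adj zero) (adj (suc zero)))
    where
    vertex≢ : ∀ {i j} → i ≢ j → vtx i ≢ vtx j
    vertex≢ i≢j e = i≢j (inj e)

  wheel-sameSign : ¬ HasNegCentral4Cycle n σ → ShortestPathsSameSign (WheelAdj n) σ
  wheel-sameSign noNeg u v 0 _ P Q = refl
  wheel-sameSign noNeg u v 1 _ P Q = trans (pathSign₁ σ P) (sym (pathSign₁ σ Q))
  wheel-sameSign noNeg u v 2 dist P Q with IsDist-2+ dist
  ... | u≢v , ¬uv = trans (shortest₂-sign noNeg u≢v ¬uv P) (sym (shortest₂-sign noNeg u≢v ¬uv Q))
  wheel-sameSign noNeg u v (suc (suc (suc k))) dist P Q with IsDist-2+ dist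
  ... | u≢v , ¬uv with proj₂ dist 2 (via-centre u≢v ¬uv)
  ...   | s≤s (s≤s ())

  module _ (4≤n : 4 ≤ n) (same : ShortestPathsSameSign (WheelAdj n) σ) where

    centred-square-positive : ∀ {z x b y} → z ≡ zero → z ≢ x → z ≢ b → z ≢ y →
      x ≢ b → b ≢ y → x ≢ y → WheelAdj n x b → WheelAdj n b y →
      σ z x · (σ x b · (σ b y · σ y z)) ≢ Sign.-
    centred-square-positive {x = zero} refl z≢x _ _ _ _ _ _ _ = ⊥-elim (z≢x refl)
    centred-square-positive {b = zero} refl _ z≢b _ _ _ _ _ _ = ⊥-elim (z≢b refl)
    centred-square-positive {y = zero} refl _ _ z≢y _ _ _ _ _ = ⊥-elim (z≢y refl)
    centred-square-positive {x = x@(suc _)} {b@(suc _)} {y@(suc _)} refl _ _ _ x≢b b≢y x≢y xb by neg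
      with trans (sym neg) square≡+
      where
      ¬xy : ¬ WheelAdj n x y
      ¬xy = rim-triangle-free 4≤n (x≢b ∘ cong suc) (b≢y ∘ cong suc) (x≢y ∘ cong suc) xb by
      through-centre : Path (WheelAdj n) x y 2
      through-centre = via-centre x≢y ¬xy
      through-b : Path (WheelAdj n) x y 2
      through-b = path₂ x≢b b≢y x≢y xb by
      halves≡ : σ zero x · σ y zero ≡ σ x b · σ b y
      halves≡ = begin
        σ zero x · σ y zero        ≡⟨ cong₂ _·_ (σ-sym zero x tt) (σ-sym y zero tt) ⟩
        σ x zero · σ zero y        ≡⟨ pathSign₂ σ through-centre ⟨
        pathSign σ through-centre
          ≡⟨ same x y 2 (IsDist-2 x≢y ¬xy through-centre) through-centre through-b ⟩
        pathSign σ through-b       ≡⟨ pathSign₂ σ through-b ⟩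
        σ x b · σ b y              ∎
      square≡+ : σ zero x · (σ x b · (σ b y · σ y zero)) ≡ Sign.+
      square≡+ = Equivalence.from (square≡+⇔ (σ zero x) (σ x b) (σ b y) (σ y zero)) halves≡
    ... | ()

    no-negative-central-square : ¬ HasNegCentral4Cycle n σ
    no-negative-central-square (C , (i , cᵢ≡0) , neg) with rotate-to-front σ C i
    ... | C′ , c₀≡cᵢ , sign≡ =
      centred-square-positive (trans c₀≡cᵢ cᵢ≡0)
        (vertex≢ (λ ())) (vertex≢ (λ ())) (vertex≢ (λ ()))
        (vertex≢ (λ ())) (vertex≢ (λ ())) (vertex≢ (λ ())) e12 e23 (trans sign≡ neg)
      where
      open Cycle4 C′
      vertex≢ : ∀ {i j} → i ≢ j → c i ≢ c j
      vertex≢ i≢j e = i≢j (distinct e)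

theorem3p2 : (n : ℕ) → 4 ≤ n → (σ : Fin (suc n) → Fin (suc n) → Sign) →
    IsSignature (WheelAdj n) σ →
    DistanceCompatible (WheelAdj n) σ ⇔ (¬ HasNegCentral4Cycle n σ)
theorem3p2 n 4≤n σ σ-sym = mk⇔
  (λ compatible → no-negative-central-square n σ σ-sym 4≤n (compatible⇒sameSign σ compatible))
  (λ noNeg → sameSign⇒compatible σ (wheel-sameSign n σ σ-sym noNeg))
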